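{- Let $m,n\in\mathbb{N}$ with $m\geq 3$ odd. For $(q,\epsilon_1,\ldots,\epsilon_{n-1})\in \mathbb{Z}_m\times\{\pm1\}^{n-1}$ define \[ \iota_n(q,\epsilon_1,\ldots,\epsilon_{n-1}) := \Big\{ v\in V(\mathbb{Z}_m^n) : v_1 + \sum_{i=1}^{n-1}\epsilon_i v_{i+1} \in \{q, q+2, \ldots, q+m-3\} \pmod m\Big\}. \] Then each $\iota_n(q,\epsilon_1,\ldots,\epsilon_{n-1})$ is a maximum independent set of $\mathbb{Z}_m^n$, and the map $\iota_n : \mathbb{Z}_m\times\{\pm 1\}^{n-1} \to \mathcal{I}^*(\mathbb{Z}_m^n)$ is injective.
   Context: The discrete torus $\mathbb{Z}_m^n$ is the graph with vertex set $\{0,1,\ldots,m-1\}^n$ in which $u,v$ are adjacent iff there is $j\in[n]$ with $u_j \equiv v_j \pm 1 \pmod m$ and $u_i=v_i$ for all $i\neq j$. $\mathcal{I}^*(G)$ denotes the set of maximum (largest cardinality) independent sets of $G$. -}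

module Defs where

open import Data.Nat using (ℕ; zero; suc; _+_; _*_; _∸_; _≤_; NonZero; ⌊_/2⌋; _≡ᵇ_)
open import Data.Nat.DivMod using (_%_)
open import Data.Fin using (Fin; toℕ)
open import Data.Vec using (Vec; []; _∷_; lookup)
open import Data.List using (List; []; _∷_; map; concatMap; length; filterᵇ; upTo)
open import Data.Bool.ListAction using (any)
open import Data.List as L using ()
open import Data.Integer as ℤ using (ℤ; +_)
open import Data.Integer.DivMod using (_%ℕ_)
open import Data.Sign using (Sign)
open import Data.Bool using (Bool; T; if_then_else_)
open import Data.Product using (∃-syntax; _×_)
open import Data.Sum using (_⊎_)
open import Relation.Binary.PropositionalEquality using (_≡_; _≢_)
open import Relation.Nullary using (¬_)

-- Congruence of naturals modulo m.
infix 4 _≡_[mod_]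
_≡_[mod_] : ℕ → ℕ → (m : ℕ) → .{{NonZero m}} → Set
a ≡ b [mod m ] = a % m ≡ b % m

-- Vertices of the torus Z_m^n: vectors in {0,…,m-1}^n.
Vertex : ℕ → ℕ → Set
Vertex m n = Vec (Fin m) n

-- Adjacency in Z_m^n: differ by ±1 (mod m) in exactly one coordinate j,
-- equal in all other coordinates.
Adjacent : (m n : ℕ) → .{{NonZero m}} → Vertex m n → Vertex m n → Set
Adjacent m n u v =
  ∃[ j ] ((toℕ (lookup u j) ≡ toℕ (lookup v j) + 1 [mod m ]
           ⊎ toℕ (lookup u j) + 1 ≡ toℕ (lookup v j) [mod m ])
         × (∀ i → i ≢ j → lookup u i ≡ lookup v i))

-- Vertex sets, as (decidable) Boolean membership predicates.
VSet : ℕ → ℕ → Set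
VSet m n = Vertex m n → Bool

-- Enumeration of all vertices of Z_m^n.
allVertices : (m n : ℕ) → List (Vertex m n)
allVertices m zero = [] ∷ []
allVertices m (suc n) = concatMap (λ x → map (x ∷_) (allVertices m n)) (L.allFin m)

-- Cardinality of a vertex set.
card : (m n : ℕ) → VSet m n → ℕ
card m n S = length (filterᵇ S (allVertices m n))

Independent : (m n : ℕ) → .{{NonZero m}} → VSet m n → Set
Independent m n S = ∀ u v → T (S u) → T (S v) → ¬ Adjacent m n u v

-- S ∈ I*(Z_m^n): independent of largest cardinality.
IsMaximumIndependent : (m n : ℕ) → .{{NonZero m}} → VSet m n → Set
IsMaximumIndependent m n S =
  Independent m n S × (∀ S′ → Independent m n S′ → card m n S′ ≤ card m n S)

-- Equality of vertex sets (extensional).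
_≐_ : {m n : ℕ} → VSet m n → VSet m n → Set
S ≐ S′ = ∀ v → S v ≡ S′ v

-- Signed term ε·x.
signed : Sign → ℕ → ℤ
signed Sign.+ x = + x
signed Sign.- x = ℤ.- (+ x)

-- Σ_{i=1}^{k} ε_i v_{i+1}
signedSum : {m k : ℕ} → Vec Sign k → Vec (Fin m) k → ℤ
signedSum [] [] = + 0
signedSum (e ∷ es) (x ∷ xs) = signed e (toℕ x) ℤ.+ signedSum es xs

-- v_1 + Σ_{i=1}^{n-1} ε_i v_{i+1}   (here n = suc k)
linForm : {m k : ℕ} → Vec Sign k → Vertex m (suc k) → ℤ
linForm ε (v₁ ∷ vs) = + toℕ v₁ ℤ.+ signedSum ε vs

-- ι_n(q, ε): vertices whose linear form lies in {q, q+2, …, q+m-3} mod m,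
-- i.e. ≡ q + 2t (mod m) for some t ∈ {0, …, (m-3)/2}.
ι : (m k : ℕ) → .{{NonZero m}} → Fin m → Vec Sign k → VSet m (suc k)
ι m k q ε v =
  any (λ t → (linForm ε v %ℕ m) ≡ᵇ ((toℕ q + 2 * t) % m)) (upTo ⌊ m ∸ 1 /2⌋)

-- Write L(v) = v₁ + ε₁v₂ + … + εₙ₋₁vₙ and h = (m − 1)/2, so that ι(q, ε) is the set of v with
-- L(v) ≡ q + 2t (mod m) for some t < h. Adjacent vertices have linear forms differing by ±1,
-- while q + 2t ≢ q + 2s + 1 for t, s < h, since 2t and 2s + 1 are distinct numbers below m.
-- So ι(q, ε) is independent.
-- Each line {(x, w) : x ∈ ℤ_m} is an m-cycle. On it an independent S and its shift S − 1 are
-- disjoint and equally large, so |S ∩ line| ≤ m/2, i.e. ≤ h since m is odd; and ι(q, ε) meets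
-- the line in at least h points, one solution x of L(x, w) ≡ q + 2t for each t < h. Summing
-- over the lines gives maximality.
-- Finally (q′, 0, …, 0) ∈ ι(q′, ε′) pins down q, and the probe (q − 1, eᵢ), whose linear form
-- is q − 1 + εᵢ, pins down εᵢ, because q − 2 ≡ q + 2t is impossible for t < h.

module Submission where

open import Defs
open import Data.Bool using (Bool; true; false; T; if_then_else_)
open import Data.Empty using (⊥; ⊥-elim)
open import Data.Fin as Fin using (Fin; toℕ; fromℕ<)
import Data.Fin.Properties as Finₚ
open import Data.Integer as ℤ using (ℤ; +_; 0ℤ; 1ℤ)
open import Data.Integer.DivMod using (_%ℕ_; _/ℕ_; n%ℕd<d; a≡a%ℕn+[a/ℕn]*n)
open import Data.Integer.Divisibility.Signed using (_∣_; divides; ∣-refl; ∣⇒∣ᵤ; ∣m⇒∣-m; ∣m∣n⇒∣m+n; ∣m∣n⇒∣m-n; ∣n⇒∣m*n)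
import Data.Integer.Properties as ℤₚ
open import Data.Integer.Tactic.RingSolver using (solve-∀)
open import Data.List as List using (List; []; _∷_; _++_; [_]; map; length; filterᵇ; concatMap; upTo; applyUpTo; tabulate; allFin)
open import Data.List.Properties using (map-++; map-∘; map-cong; map-tabulate; map-applyUpTo; upTo-∷ʳ; length-applyUpTo)
open import Data.List.Membership.Propositional using (_∈_)
open import Data.List.Membership.Propositional.Properties using (∈-filter⁺; ∈-allFin)
open import Data.List.Relation.Unary.Any using (index)
open import Data.List.Relation.Unary.Any.Properties using (lookup-index; any⁺; any⁻; applyUpTo⁺; applyUpTo⁻)
open import Data.Nat using (ℕ; zero; suc; _+_; _*_; _∸_; _≤_; _<_; z≤n; s≤s; NonZero; >-nonZero⁻¹; ⌊_/2⌋; ⌈_/2⌉; z<s)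
open import Data.Nat.DivMod using (_%_; _/_; _mod_; m%n%n≡m%n; n%n≡0; m<n⇒m%n≡m; %-distribˡ-+; m≡m%n+[m/n]*n)
open import Data.Nat.Divisibility using (n∣m⇒m%n≡0)
open import Data.Nat.ListAction using (sum)
open import Data.Nat.ListAction.Properties using (sum-++)
open import Data.Nat.Properties
import Data.Nat.Tactic.RingSolver as ℕ-Solver
open import Algebra.Properties.CommutativeSemigroup +-commutativeSemigroup using (interchange)
open import Data.Product using (∃-syntax; _×_; _,_)
open import Data.Sign as Sign using (Sign)
open import Data.Sum as Sum using (_⊎_; inj₁; inj₂)
open import Data.Vec as Vec using (Vec; []; _∷_; lookup; replicate; _[_]≔_)
import Data.Vec.Properties as Vecₚ
open import Function using (_∘_; id)
open import Function.Definitions using (Injective)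
open import Level using (0ℓ)
open import Relation.Binary.Bundles using (Setoid)
import Relation.Binary.Reasoning.Setoid as SetoidReasoning
open import Relation.Binary.PropositionalEquality using (_≡_; refl; sym; trans; cong; cong₂; subst; subst₂; module ≡-Reasoning)
open import Relation.Nullary using (¬_)
open import Relation.Nullary.Decidable using (T?)

-- Counting elements of lists

private variable
  A B C : Set

indicator : Bool → ℕ
indicator b = if b then 1 else 0

count : (A → Bool) → List A → ℕ
count p xs = sum (map (indicator ∘ p) xs)

length-filterᵇ : (p : A → Bool) (xs : List A) → length (filterᵇ p xs) ≡ count p xs
length-filterᵇ p []       = refl
length-filterᵇ p (x ∷ xs) with p x
... | true  = cong suc (length-filterᵇ p xs)
... | false = length-filterᵇ p xs

sum-map-zero : (xs : List A) → sum (map (λ _ → 0) xs) ≡ 0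
sum-map-zero []       = refl
sum-map-zero (x ∷ xs) = sum-map-zero xs

sum-map-+ : (f g : A → ℕ) (xs : List A) →
            sum (map (λ x → f x + g x) xs) ≡ sum (map f xs) + sum (map g xs)
sum-map-+ f g []       = refl
sum-map-+ f g (x ∷ xs) = trans (cong (_+_ (f x + g x)) (sum-map-+ f g xs))
                               (interchange (f x) (g x) (sum (map f xs)) (sum (map g xs)))

sum-map-mono : {f g : A → ℕ} (xs : List A) → (∀ x → f x ≤ g x) → sum (map f xs) ≤ sum (map g xs)
sum-map-mono []       f≤g = z≤n
sum-map-mono (x ∷ xs) f≤g = +-mono-≤ (f≤g x) (sum-map-mono xs f≤g)

sum-concatMap-map : (g : C → ℕ) (f : A → B → C) (xs : List A) (ys : List B) →
                    sum (map g (concatMap (λ x → map (f x) ys) xs))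
                      ≡ sum (map (λ y → sum (map (λ x → g (f x y)) xs)) ys)
sum-concatMap-map g f []       ys = sym (sum-map-zero ys)
sum-concatMap-map g f (x ∷ xs) ys = begin
  sum (map g (map (f x) ys ++ rest))                     ≡⟨ cong sum (map-++ g (map (f x) ys) rest) ⟩
  sum (map g (map (f x) ys) ++ map g rest)               ≡⟨ sum-++ (map g (map (f x) ys)) (map g rest) ⟩
  sum (map g (map (f x) ys)) + sum (map g rest)
    ≡⟨ cong₂ _+_ (cong sum (sym (map-∘ ys))) (sum-concatMap-map g f xs ys) ⟩
  sum (map (g ∘ f x) ys) + sum (map (λ y → sum (map (λ x → g (f x y)) xs)) ys)
    ≡⟨ sum-map-+ (g ∘ f x) (λ y → sum (map (λ x → g (f x y)) xs)) ys ⟨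
  sum (map (λ y → sum (map (λ x → g (f x y)) (x ∷ xs))) ys) ∎
  where
  open ≡-Reasoning
  rest = concatMap (λ x → map (f x) ys) xs

count-++ : (p : A → Bool) (xs ys : List A) → count p (xs ++ ys) ≡ count p xs + count p ys
count-++ p xs ys =
  trans (cong sum (map-++ (indicator ∘ p) xs ys)) (sum-++ (map (indicator ∘ p) xs) (map (indicator ∘ p) ys))

count-map : (p : B → Bool) (f : A → B) (xs : List A) → count p (map f xs) ≡ count (p ∘ f) xs
count-map p f xs = cong sum (sym (map-∘ xs))

count-cong : {p q : A → Bool} (xs : List A) → (∀ x → p x ≡ q x) → count p xs ≡ count q xs
count-cong xs p≗q = cong sum (map-cong (cong indicator ∘ p≗q) xs)

count-disjoint : (p q : A → Bool) (xs : List A) → (∀ x → T (p x) → T (q x) → ⊥) →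
                 count p xs + count q xs ≤ length xs
count-disjoint p q []       disjoint = z≤n
count-disjoint p q (x ∷ xs) disjoint =
  ≤-trans (≤-reflexive (interchange (indicator (p x)) (count p xs) (indicator (q x)) (count q xs)))
          (+-mono-≤ (indicators≤1 (p x) (q x) (disjoint x)) (count-disjoint p q xs disjoint))
  where
  indicators≤1 : ∀ a b → (T a → T b → ⊥) → indicator a + indicator b ≤ 1
  indicators≤1 true  true  ¬ab = ⊥-elim (¬ab _ _)
  indicators≤1 true  false _   = ≤-refl
  indicators≤1 false true  _   = ≤-refl
  indicators≤1 false false _   = z≤n

count-≥-injective : ∀ {n} (p : A → Bool) (xs : List A) (g : Fin n → A) → Injective _≡_ _≡_ g →
                    (∀ i → g i ∈ xs) → (∀ i → T (p (g i))) → n ≤ count p xs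
count-≥-injective {n = n} p xs g g-injective g∈xs pg =
  subst (n ≤_) (length-filterᵇ p xs) (Finₚ.injective⇒≤ position-injective)
  where
  selected = filterᵇ p xs
  membership : ∀ i → g i ∈ selected
  membership i = ∈-filter⁺ (T? ∘ p) (g∈xs i) (pg i)
  position-injective : Injective _≡_ _≡_ (λ i → index (membership i))
  position-injective {i} {j} same = g-injective (begin
    g i                                          ≡⟨ lookup-index (membership i) ⟩
    List.lookup selected (index (membership i))  ≡⟨ cong (List.lookup selected) same ⟩
    List.lookup selected (index (membership j))  ≡⟨ lookup-index (membership j) ⟨
    g j                                          ∎)
    where open ≡-Reasoning

map-toℕ-allFin : ∀ n → map toℕ (allFin n) ≡ upTo n
map-toℕ-allFin zero    = refl
map-toℕ-allFin (suc n) = cong (0 ∷_) (begin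
  map toℕ (tabulate Fin.suc)     ≡⟨ map-tabulate Fin.suc toℕ ⟩
  tabulate (suc ∘ toℕ)           ≡⟨ map-tabulate toℕ suc ⟨
  map suc (tabulate toℕ)         ≡⟨ cong (map suc) (trans (sym (map-tabulate id toℕ)) (map-toℕ-allFin n)) ⟩
  map suc (upTo n)               ≡⟨ map-applyUpTo id suc n ⟩
  applyUpTo suc n                ∎)
  where open ≡-Reasoning

-- Independent sets of a cycle

count-rotate : (F : ℕ → Bool) (n : ℕ) → F n ≡ F 0 → count (F ∘ suc) (upTo n) ≡ count F (upTo n)
count-rotate F n periodic = +-cancelˡ-≡ (indicator (F 0)) _ _ (begin
  indicator (F 0) + count (F ∘ suc) (upTo n)    ≡⟨ cong (_+_ (indicator (F 0))) (count-map F suc (upTo n)) ⟨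
  indicator (F 0) + count F (map suc (upTo n))  ≡⟨ cong (λ xs → count F (0 ∷ xs)) (map-applyUpTo id suc n) ⟩
  count F (upTo (suc n))                        ≡⟨ cong (count F) (upTo-∷ʳ n) ⟨
  count F (upTo n ++ [ n ])                     ≡⟨ count-++ F (upTo n) [ n ] ⟩
  count F (upTo n) + count F [ n ]              ≡⟨ cong (λ b → count F (upTo n) + (indicator b + 0)) periodic ⟩
  count F (upTo n) + count F [ 0 ]              ≡⟨ +-comm (count F (upTo n)) (indicator (F 0) + 0) ⟩
  count F [ 0 ] + count F (upTo n)              ≡⟨ cong (_+ count F (upTo n)) (+-identityʳ (indicator (F 0))) ⟩
  indicator (F 0) + count F (upTo n)            ∎)
  where open ≡-Reasoning

module _ (m : ℕ) .{{_ : NonZero m}} where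

  toℕ-mod : (x : Fin m) → toℕ x mod m ≡ x
  toℕ-mod x = Finₚ.toℕ-injective (trans (Finₚ.toℕ-fromℕ< _) (m<n⇒m%n≡m (Finₚ.toℕ<n x)))

  suc-mod : ∀ n → toℕ (n mod m) + 1 ≡ toℕ (suc n mod m) [mod m ]
  suc-mod n = begin
    (toℕ (n mod m) + 1) % m      ≡⟨ cong (λ a → (a + 1) % m) (Finₚ.toℕ-fromℕ< _) ⟩
    (n % m + 1) % m              ≡⟨ %-distribˡ-+ (n % m) 1 m ⟩
    (n % m % m + 1 % m) % m      ≡⟨ cong (λ a → (a + 1 % m) % m) (m%n%n≡m%n n m) ⟩
    (n % m + 1 % m) % m          ≡⟨ %-distribˡ-+ n 1 m ⟨
    (n + 1) % m                  ≡⟨ cong (_% m) (+-comm n 1) ⟩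
    suc n % m                    ≡⟨ m%n%n≡m%n (suc n) m ⟨
    suc n % m % m                ≡⟨ cong (_% m) (Finₚ.toℕ-fromℕ< _) ⟨
    toℕ (suc n mod m) % m        ∎
    where open ≡-Reasoning

  cycle-independent-count : (f : Fin m → Bool) →
    (∀ x y → toℕ x + 1 ≡ toℕ y [mod m ] → T (f x) → T (f y) → ⊥) →
    count f (allFin m) + count f (allFin m) ≤ m
  cycle-independent-count f independent = begin
    count f (allFin m) + count f (allFin m)      ≡⟨ cong₂ _+_ on-upTo (trans on-upTo (sym rotated)) ⟩
    count F (upTo m) + count (F ∘ suc) (upTo m)
      ≤⟨ count-disjoint F (F ∘ suc) (upTo m) (λ n → independent _ _ (suc-mod n)) ⟩
    length (upTo m)                              ≡⟨ length-applyUpTo id m ⟩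
    m                                            ∎
    where
    open ≤-Reasoning
    F : ℕ → Bool
    F n = f (n mod m)
    on-upTo : count f (allFin m) ≡ count F (upTo m)
    on-upTo = begin-equality
      count f (allFin m)             ≡⟨ count-cong (allFin m) (cong f ∘ sym ∘ toℕ-mod) ⟩
      count (F ∘ toℕ) (allFin m)     ≡⟨ count-map F toℕ (allFin m) ⟨
      count F (map toℕ (allFin m))   ≡⟨ cong (count F) (map-toℕ-allFin m) ⟩
      count F (upTo m)               ∎
    rotated : count (F ∘ suc) (upTo m) ≡ count F (upTo m)
    rotated = count-rotate F m (cong f (Finₚ.toℕ-injective (begin-equality
      toℕ (m mod m) ≡⟨ Finₚ.toℕ-fromℕ< _ ⟩
      m % m         ≡⟨ n%n≡0 m ⟩
      0             ≡⟨ m<n⇒m%n≡m (>-nonZero⁻¹ m) ⟨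
      0 % m         ≡⟨ Finₚ.toℕ-fromℕ< _ ⟨
      toℕ (0 mod m) ∎)))

-- Congruence modulo m on ℤ

module ModularArithmetic (m : ℕ) .{{_ : NonZero m}} where

  infix 4 _≋_
  record _≋_ (x y : ℤ) : Set where
    constructor mk≋
    field residue-≡ : x %ℕ m ≡ y %ℕ m
  open _≋_

  ≋-setoid : Setoid 0ℓ 0ℓ
  ≋-setoid = record
    { Carrier       = ℤ
    ; _≈_           = _≋_
    ; isEquivalence = record
      { refl  = mk≋ refl
      ; sym   = λ x≋y → mk≋ (sym (residue-≡ x≋y))
      ; trans = λ x≋y y≋z → mk≋ (trans (residue-≡ x≋y) (residue-≡ y≋z))
      }
    }

  open Setoid ≋-setoid public using () renaming (refl to ≋-refl; sym to ≋-sym; trans to ≋-trans; reflexive to ≡⇒≋)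

  ≋⇒≡ : ∀ {a b} → a < m → b < m → + a ≋ + b → a ≡ b
  ≋⇒≡ a<m b<m (mk≋ a%m≡b%m) = trans (sym (m<n⇒m%n≡m a<m)) (trans a%m≡b%m (m<n⇒m%n≡m b<m))

  residue-≋ : ∀ x → + (x %ℕ m) ≋ x
  residue-≋ x = mk≋ (m<n⇒m%n≡m (n%ℕd<d x m))

  private
    M : ℤ
    M = + m

    -- b − a is a multiple of m smaller than m, hence 0.
    ∣-≤⇒≤ : ∀ {a b} → a ≤ b → b < m → M ∣ + b ℤ.- + a → b ≤ a
    ∣-≤⇒≤ {a} {b} a≤b b<m m∣b-a = m∸n≡0⇒m≤n (trans (sym (m<n⇒m%n≡m b∸a<m)) (n∣m⇒m%n≡0 (b ∸ a) m (∣⇒∣ᵤ m∣b∸a)))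
      where
      b∸a<m = ≤-<-trans (m∸n≤m b a) b<m
      m∣b∸a : M ∣ + (b ∸ a)
      m∣b∸a = subst (M ∣_) (trans (ℤₚ.m-n≡m⊖n b a) (ℤₚ.⊖-≥ a≤b)) m∣b-a

    residues-equal : ∀ {a b} → a < m → b < m → M ∣ + a ℤ.- + b → a ≡ b
    residues-equal {a} {b} a<m b<m m∣a-b with ≤-total a b
    ... | inj₁ a≤b = ≤-antisym a≤b (∣-≤⇒≤ a≤b b<m (subst (M ∣_) (negate-difference (+ a) (+ b)) (∣m⇒∣-m m∣a-b)))
      where
      negate-difference : ∀ x y → ℤ.- (x ℤ.- y) ≡ y ℤ.- x
      negate-difference = solve-∀
    ... | inj₂ b≤a = sym (≤-antisym b≤a (∣-≤⇒≤ b≤a a<m m∣a-b))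

    ≋⇒∣ : ∀ {x y} → x ≋ y → M ∣ x ℤ.- y
    ≋⇒∣ {x} {y} (mk≋ same-residue) = divides (x /ℕ m ℤ.- y /ℕ m) (begin
      x ℤ.- y                                           ≡⟨ cong₂ ℤ._-_ (a≡a%ℕn+[a/ℕn]*n x m) (a≡a%ℕn+[a/ℕn]*n y m) ⟩
      (+ (x %ℕ m) ℤ.+ x /ℕ m ℤ.* M) ℤ.- (+ (y %ℕ m) ℤ.+ y /ℕ m ℤ.* M)
        ≡⟨ cong (λ r → (+ r ℤ.+ x /ℕ m ℤ.* M) ℤ.- (+ (y %ℕ m) ℤ.+ y /ℕ m ℤ.* M)) same-residue ⟩
      (+ (y %ℕ m) ℤ.+ x /ℕ m ℤ.* M) ℤ.- (+ (y %ℕ m) ℤ.+ y /ℕ m ℤ.* M)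
        ≡⟨ cancel (+ (y %ℕ m)) (x /ℕ m) (y /ℕ m) M ⟩
      (x /ℕ m ℤ.- y /ℕ m) ℤ.* M                         ∎)
      where
      open ≡-Reasoning
      cancel : ∀ r a b n → (r ℤ.+ a ℤ.* n) ℤ.- (r ℤ.+ b ℤ.* n) ≡ (a ℤ.- b) ℤ.* n
      cancel = solve-∀

    ∣⇒≋ : ∀ {x y} → M ∣ x ℤ.- y → x ≋ y
    ∣⇒≋ {x} {y} m∣x-y = mk≋ (residues-equal (n%ℕd<d x m) (n%ℕd<d y m)
      (subst (M ∣_) remainders (∣m∣n⇒∣m-n m∣x-y (∣n⇒∣m*n (x /ℕ m ℤ.- y /ℕ m) ∣-refl))))
      where
      open ≡-Reasoning
      cancel : ∀ r s a b n → ((r ℤ.+ a ℤ.* n) ℤ.- (s ℤ.+ b ℤ.* n)) ℤ.- (a ℤ.- b) ℤ.* n ≡ r ℤ.- s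
      cancel = solve-∀
      remainders : (x ℤ.- y) ℤ.- (x /ℕ m ℤ.- y /ℕ m) ℤ.* M ≡ + (x %ℕ m) ℤ.- + (y %ℕ m)
      remainders = begin
        (x ℤ.- y) ℤ.- (x /ℕ m ℤ.- y /ℕ m) ℤ.* M
          ≡⟨ cong₂ (λ x′ y′ → (x′ ℤ.- y′) ℤ.- (x /ℕ m ℤ.- y /ℕ m) ℤ.* M)
                   (a≡a%ℕn+[a/ℕn]*n x m) (a≡a%ℕn+[a/ℕn]*n y m) ⟩
        ((+ (x %ℕ m) ℤ.+ x /ℕ m ℤ.* M) ℤ.- (+ (y %ℕ m) ℤ.+ y /ℕ m ℤ.* M)) ℤ.- (x /ℕ m ℤ.- y /ℕ m) ℤ.* M
          ≡⟨ cancel (+ (x %ℕ m)) (+ (y %ℕ m)) (x /ℕ m) (y /ℕ m) M ⟩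
        + (x %ℕ m) ℤ.- + (y %ℕ m) ∎

  ≋-+ : ∀ {x y u v} → x ≋ y → u ≋ v → x ℤ.+ u ≋ y ℤ.+ v
  ≋-+ {x} {y} {u} {v} x≋y u≋v = ∣⇒≋ (subst (M ∣_) (regroup x y u v) (∣m∣n⇒∣m+n (≋⇒∣ x≋y) (≋⇒∣ u≋v)))
    where
    regroup : ∀ x y u v → (x ℤ.- y) ℤ.+ (u ℤ.- v) ≡ (x ℤ.+ u) ℤ.- (y ℤ.+ v)
    regroup = solve-∀

  ≋-neg : ∀ {x y} → x ≋ y → ℤ.- x ≋ ℤ.- y
  ≋-neg {x} {y} x≋y = ∣⇒≋ (subst (M ∣_) (negate x y) (∣m⇒∣-m (≋⇒∣ x≋y)))
    where
    negate : ∀ x y → ℤ.- (x ℤ.- y) ≡ ℤ.- x ℤ.- ℤ.- y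
    negate = solve-∀

  -- Residues one step apart on the cycle ℤ_m; on + a and + b this unfolds to the step relation
  -- of Adjacent.
  infix 4 _~_
  _~_ : ℤ → ℤ → Set
  x ~ y = x ≋ y ℤ.+ 1ℤ ⊎ x ℤ.+ 1ℤ ≋ y

  ~-resp-≋ : ∀ {x x′ y y′} → x ≋ x′ → y ≋ y′ → x ~ y → x′ ~ y′
  ~-resp-≋ x≋x′ y≋y′ (inj₁ x≋y+1) = inj₁ (≋-trans (≋-sym x≋x′) (≋-trans x≋y+1 (≋-+ y≋y′ (≋-refl {1ℤ}))))
  ~-resp-≋ x≋x′ y≋y′ (inj₂ x+1≋y) = inj₂ (≋-trans (≋-+ (≋-sym x≋x′) (≋-refl {1ℤ})) (≋-trans x+1≋y y≋y′))

  ~-+ʳ : ∀ z {x y} → x ~ y → x ℤ.+ z ~ y ℤ.+ z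
  ~-+ʳ z {x} {y} (inj₁ x≋y+1) = inj₁ (≋-trans (≋-+ x≋y+1 (≋-refl {z})) (≡⇒≋ (+1-swap y z)))
    where
    +1-swap : ∀ a b → (a ℤ.+ 1ℤ) ℤ.+ b ≡ (a ℤ.+ b) ℤ.+ 1ℤ
    +1-swap = solve-∀
  ~-+ʳ z {x} {y} (inj₂ x+1≋y) = inj₂ (≋-trans (≡⇒≋ (+1-swap x z)) (≋-+ x+1≋y (≋-refl {z})))
    where
    +1-swap : ∀ a b → (a ℤ.+ b) ℤ.+ 1ℤ ≡ (a ℤ.+ 1ℤ) ℤ.+ b
    +1-swap = solve-∀

  ~-+ˡ : ∀ z {x y} → x ~ y → z ℤ.+ x ~ z ℤ.+ y
  ~-+ˡ z {x} {y} x~y = subst₂ _~_ (ℤₚ.+-comm x z) (ℤₚ.+-comm y z) (~-+ʳ z x~y)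

  ~-neg : ∀ {x y} → x ~ y → ℤ.- x ~ ℤ.- y
  ~-neg {x} {y} (inj₁ x≋y+1) = inj₂ (≋-trans (≋-+ (≋-neg x≋y+1) (≋-refl {1ℤ})) (≡⇒≋ (cancel y)))
    where
    cancel : ∀ a → ℤ.- (a ℤ.+ 1ℤ) ℤ.+ 1ℤ ≡ ℤ.- a
    cancel = solve-∀
  ~-neg {x} {y} (inj₂ x+1≋y) = inj₁ (≋-trans (≡⇒≋ (cancel x)) (≋-+ (≋-neg x+1≋y) (≋-refl {1ℤ})))
    where
    cancel : ∀ a → ℤ.- a ≡ ℤ.- (a ℤ.+ 1ℤ) ℤ.+ 1ℤ
    cancel = solve-∀

  ≋-+-cancelˡ : ∀ z {x y} → z ℤ.+ x ≋ z ℤ.+ y → x ≋ y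
  ≋-+-cancelˡ z {x} {y} z+x≋z+y = begin
    x                    ≡⟨ cancel z x ⟩
    ℤ.- z ℤ.+ (z ℤ.+ x)  ≈⟨ ≋-+ (≋-refl {ℤ.- z}) z+x≋z+y ⟩
    ℤ.- z ℤ.+ (z ℤ.+ y)  ≡⟨ cancel z y ⟨
    y                    ∎
    where
    open SetoidReasoning ≋-setoid
    cancel : ∀ a b → b ≡ ℤ.- a ℤ.+ (a ℤ.+ b)
    cancel = solve-∀

-- The sets ι(q, ε)

[m+n]+1≡m+[1+n] : ∀ a b → a + b + 1 ≡ a + suc b
[m+n]+1≡m+[1+n] a b = trans (+-assoc a b 1) (cong (_+_ a) (+-comm b 1))

m+2*[1+n]≡m+2*n+2 : ∀ a t → a + 2 * suc t ≡ a + 2 * t + 2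
m+2*[1+n]≡m+2*n+2 = ℕ-Solver.solve-∀

c+c≤1+n+n⇒c≤n : ∀ {c n} → c + c ≤ suc (n + n) → c ≤ n
c+c≤1+n+n⇒c≤n {c} {n} c+c≤1+n+n = ≮⇒≥ λ n<c →
  1+n≰n (≤-trans (≤-reflexive (sym (+-suc (suc n) n))) (≤-trans (+-mono-≤ n<c n<c) c+c≤1+n+n))

module Torus (m : ℕ) .{{_ : NonZero m}} where

  open ModularArithmetic m

  fromℤ : ℤ → Fin m
  fromℤ z = fromℕ< (n%ℕd<d z m)

  toℕ-fromℤ : ∀ z → + toℕ (fromℤ z) ≋ z
  toℕ-fromℤ z = ≋-trans (≡⇒≋ (cong +_ (Finₚ.toℕ-fromℕ< _))) (residue-≋ z)

  linForm-fromℤ : ∀ {k} (ε : Vec Sign k) (w : Vec (Fin m) k) z →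
                  linForm ε (fromℤ (z ℤ.- signedSum ε w) ∷ w) ≋ z
  linForm-fromℤ ε w z = ≋-trans (≋-+ (toℕ-fromℤ (z ℤ.- s)) (≋-refl {s})) (≡⇒≋ (cancel z s))
    where
    s = signedSum ε w
    cancel : ∀ a b → (a ℤ.- b) ℤ.+ b ≡ a
    cancel = solve-∀

  Adjacent-∷⁻ : ∀ {n x y} {u v : Vec (Fin m) n} → Adjacent m (suc n) (x ∷ u) (y ∷ v) →
                (+ toℕ x ~ + toℕ y × u ≡ v) ⊎ (x ≡ y × Adjacent m n u v)
  Adjacent-∷⁻ {u = u} {v} (Fin.zero , step , others) =
    inj₁ (Sum.map mk≋ mk≋ step , (begin
      u                      ≡⟨ Vecₚ.tabulate∘lookup u ⟨
      Vec.tabulate (lookup u) ≡⟨ Vecₚ.tabulate-cong (λ i → others (Fin.suc i) λ ()) ⟩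
      Vec.tabulate (lookup v) ≡⟨ Vecₚ.tabulate∘lookup v ⟩
      v                      ∎))
    where open ≡-Reasoning
  Adjacent-∷⁻ (Fin.suc j , step , others) =
    inj₂ (others Fin.zero (λ ()) , j , step , λ i i≢j → others (Fin.suc i) (i≢j ∘ Finₚ.suc-injective))

  signed-~ : ∀ e {a b} → + a ~ + b → signed e a ~ signed e b
  signed-~ Sign.+ a~b = a~b
  signed-~ Sign.- a~b = ~-neg a~b

  signedSum-adjacent : ∀ {n} (ε : Vec Sign n) {u v : Vec (Fin m) n} → Adjacent m n u v →
                       signedSum ε u ~ signedSum ε v
  signedSum-adjacent [] {[]} {[]} (() , _)
  signedSum-adjacent (e ∷ ε) {x ∷ u} {y ∷ v} adjacent with Adjacent-∷⁻ adjacent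
  ... | inj₁ (x~y , refl) = ~-+ʳ (signedSum ε u) (signed-~ e x~y)
  ... | inj₂ (refl , u-v) = ~-+ˡ (signed e (toℕ x)) (signedSum-adjacent ε u-v)

  -- linForm ε is the signed sum with coefficient vector (+ ∷ ε).
  linForm-adjacent : ∀ {k} (ε : Vec Sign k) {u v : Vertex m (suc k)} → Adjacent m (suc k) u v →
                     linForm ε u ~ linForm ε v
  linForm-adjacent ε {_ ∷ _} {_ ∷ _} = signedSum-adjacent (Sign.+ ∷ ε)

  h : ℕ
  h = ⌊ m ∸ 1 /2⌋

  2*t<m : ∀ {t} → t ≤ h → 2 * t < m
  2*t<m {t} t≤h = begin-strict
    2 * t            ≤⟨ *-monoʳ-≤ 2 t≤h ⟩
    2 * h            ≡⟨ cong (_+_ h) (+-identityʳ h) ⟩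
    h + h            ≤⟨ +-monoʳ-≤ h (⌊n/2⌋≤⌈n/2⌉ (m ∸ 1)) ⟩
    h + ⌈ m ∸ 1 /2⌉  ≡⟨ ⌊n/2⌋+⌈n/2⌉≡n (m ∸ 1) ⟩
    m ∸ 1            <⟨ ∸-monoʳ-< z<s (>-nonZero⁻¹ m) ⟩
    m                ∎
    where open ≤-Reasoning

  1+2*t<m : ∀ {t} → t < h → suc (2 * t) < m
  1+2*t<m {t} t<h = <-trans (≤-reflexive (sym (*-suc 2 t))) (2*t<m t<h)

  offset-injective : ∀ a {t s} → t ≤ h → s ≤ h → + (a + 2 * t) ≋ + (a + 2 * s) → t ≡ s
  offset-injective a {t} {s} t≤h s≤h same =
    *-cancelˡ-≡ t s 2 (≋⇒≡ (2*t<m t≤h) (2*t<m s≤h) (≋-+-cancelˡ (+ a) {+ (2 * t)} {+ (2 * s)} same))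

  offsets-not-adjacent : ∀ a {t s} → t < h → s < h → ¬ (+ (a + 2 * t) ~ + (a + 2 * s))
  offsets-not-adjacent a {t} {s} t<h s<h (inj₁ a+2t≋a+2s+1) =
    even≢odd t s (≋⇒≡ (2*t<m (<⇒≤ t<h)) (1+2*t<m s<h) (≋-+-cancelˡ (+ a) (begin
      + a ℤ.+ + (2 * t)      ≈⟨ a+2t≋a+2s+1 ⟩
      + (a + 2 * s) ℤ.+ 1ℤ   ≡⟨ cong +_ ([m+n]+1≡m+[1+n] a (2 * s)) ⟩
      + a ℤ.+ + suc (2 * s)  ∎)))
    where open SetoidReasoning ≋-setoid
  offsets-not-adjacent a {t} {s} t<h s<h (inj₂ a+2t+1≋a+2s) =
    even≢odd s t (sym (≋⇒≡ (1+2*t<m t<h) (2*t<m (<⇒≤ s<h)) (≋-+-cancelˡ (+ a) (begin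
      + a ℤ.+ + suc (2 * t)  ≡⟨ cong +_ ([m+n]+1≡m+[1+n] a (2 * t)) ⟨
      + (a + 2 * t) ℤ.+ 1ℤ   ≈⟨ a+2t+1≋a+2s ⟩
      + a ℤ.+ + (2 * s)      ∎))))
    where open SetoidReasoning ≋-setoid

  ι⁻ : ∀ {k} (q : Fin m) (ε : Vec Sign k) v → T (ι m k q ε v) →
       ∃[ t ] (t < h × linForm ε v ≋ + (toℕ q + 2 * t))
  ι⁻ q ε v v∈ι with applyUpTo⁻ id (any⁻ _ (upTo h) v∈ι)
  ... | t , t<h , same-residue = t , t<h , mk≋ (≡ᵇ⇒≡ _ _ same-residue)

  ι⁺ : ∀ {k} (q : Fin m) (ε : Vec Sign k) v {t} → t < h → linForm ε v ≋ + (toℕ q + 2 * t) →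
       T (ι m k q ε v)
  ι⁺ q ε v t<h (mk≋ same-residue) = any⁺ _ (applyUpTo⁺ id (≡⇒≡ᵇ _ _ same-residue) t<h)

  -- q − 2 ≡ q + 2t would give 2(t + 1) ≡ 0 with 0 < 2(t + 1) < m.
  q-2∉ι : ∀ {k} (q : Fin m) (ε : Vec Sign k) v → linForm ε v ≋ + toℕ q ℤ.- + 2 → ¬ T (ι m k q ε v)
  q-2∉ι q ε v v≋q-2 v∈ι with ι⁻ q ε v v∈ι
  ... | t , t<h , v≋q+2t = 0≢1+n (offset-injective (toℕ q) z≤n t<h (begin
    + (toℕ q + 2 * 0)                ≡⟨ cong +_ (+-identityʳ (toℕ q)) ⟩
    + toℕ q                          ≡⟨ add-back (+ toℕ q) ⟩
    (+ toℕ q ℤ.- + 2) ℤ.+ + 2        ≈⟨ ≋-+ (≋-trans (≋-sym v≋q-2) v≋q+2t) (≋-refl {+ 2}) ⟩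
    + (toℕ q + 2 * t) ℤ.+ + 2        ≡⟨ cong +_ (m+2*[1+n]≡m+2*n+2 (toℕ q) t) ⟨
    + (toℕ q + 2 * suc t)            ∎))
    where
    open SetoidReasoning ≋-setoid
    add-back : ∀ x → x ≡ (x ℤ.- + 2) ℤ.+ + 2
    add-back = solve-∀

  ι-independent : ∀ {k} (q : Fin m) (ε : Vec Sign k) → Independent m (suc k) (ι m k q ε)
  ι-independent q ε u v u∈ι v∈ι u-v with ι⁻ q ε u u∈ι | ι⁻ q ε v v∈ι
  ... | t , t<h , Lu≋ | s , s<h , Lv≋ =
    offsets-not-adjacent (toℕ q) t<h s<h (~-resp-≋ Lu≋ Lv≋ (linForm-adjacent ε {u} {v} u-v))

  fibre : ∀ {k} → VSet m (suc k) → Vec (Fin m) k → ℕ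
  fibre S w = count (λ x → S (x ∷ w)) (allFin m)

  card-fibres : ∀ {k} (S : VSet m (suc k)) → card m (suc k) S ≡ sum (map (fibre S) (allVertices m k))
  card-fibres {k} S = trans (length-filterᵇ S (allVertices m (suc k)))
                            (sum-concatMap-map (indicator ∘ S) _∷_ (allFin m) (allVertices m k))

  -- Each fibre {x ∷ w} is a cycle of length m in the first coordinate.
  independent-fibre-≤ : ∀ {k} {S : VSet m (suc k)} → Independent m (suc k) S → ∀ w →
                      fibre S w + fibre S w ≤ m
  independent-fibre-≤ {S = S} independent w =
    cycle-independent-count m (λ x → S (x ∷ w)) λ x y step Sx Sy →
      independent (x ∷ w) (y ∷ w) Sx Sy (Fin.zero , inj₂ step , λ where
        Fin.zero    0≢0 → ⊥-elim (0≢0 refl)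
        (Fin.suc i) _   → refl)

  ι-fibre-≥ : ∀ {k} (q : Fin m) (ε : Vec Sign k) w → h ≤ fibre (ι m k q ε) w
  ι-fibre-≥ q ε w = count-≥-injective _ (allFin m) solution solution-injective
    (λ t → ∈-allFin (solution t)) (λ t → ι⁺ q ε _ (Finₚ.toℕ<n t) (linForm-fromℤ ε w (offset t)))
    where
    offset : Fin h → ℤ
    offset t = + (toℕ q + 2 * toℕ t)
    solution : Fin h → Fin m
    solution t = fromℤ (offset t ℤ.- signedSum ε w)
    solution-injective : Injective _≡_ _≡_ solution
    solution-injective {t} {s} same = Finₚ.toℕ-injective
      (offset-injective (toℕ q) (<⇒≤ (Finₚ.toℕ<n t)) (<⇒≤ (Finₚ.toℕ<n s))
        (≋-trans (≋-sym (linForm-fromℤ ε w (offset t)))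
          (≋-trans (≡⇒≋ (cong (λ x → linForm ε (x ∷ w)) same)) (linForm-fromℤ ε w (offset s)))))

  odd⇒m≡1+h+h : m % 2 ≡ 1 → m ≡ suc (h + h)
  odd⇒m≡1+h+h odd = trans m≡1+j+j (cong (λ n → suc (n + n)) (sym h≡j))
    where
    j = m / 2
    m≡1+j+j : m ≡ suc (j + j)
    m≡1+j+j = trans (m≡m%n+[m/n]*n m 2) (cong₂ _+_ odd (trans (*-comm j 2) (cong (_+_ j) (+-identityʳ j))))
    h≡j : h ≡ j
    h≡j = trans (cong (λ n → ⌊ n ∸ 1 /2⌋) m≡1+j+j) (sym (n≡⌊n+n/2⌋ j))

  ι-maximum : ∀ {k} (q : Fin m) (ε : Vec Sign k) → m % 2 ≡ 1 →
              ∀ S → Independent m (suc k) S → card m (suc k) S ≤ card m (suc k) (ι m k q ε)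
  ι-maximum {k} q ε odd S independent = begin
    card m (suc k) S                         ≡⟨ card-fibres S ⟩
    sum (map (fibre S) vertices)             ≤⟨ sum-map-mono vertices fibre-≤-h ⟩
    sum (map (λ _ → h) vertices)             ≤⟨ sum-map-mono vertices (ι-fibre-≥ q ε) ⟩
    sum (map (fibre (ι m k q ε)) vertices)   ≡⟨ card-fibres (ι m k q ε) ⟨
    card m (suc k) (ι m k q ε)               ∎
    where
    open ≤-Reasoning
    vertices = allVertices m k
    fibre-≤-h : ∀ w → fibre S w ≤ h
    fibre-≤-h w =
      c+c≤1+n+n⇒c≤n (subst (fibre S w + fibre S w ≤_) (odd⇒m≡1+h+h odd) (independent-fibre-≤ independent w))

-- Injectivity of ι

lookup-extensionality : ∀ {A : Set} {n} {u v : Vec A n} → (∀ i → lookup u i ≡ lookup v i) → u ≡ v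
lookup-extensionality {u = u} {v} same = begin
  u                       ≡⟨ Vecₚ.tabulate∘lookup u ⟨
  Vec.tabulate (lookup u) ≡⟨ Vecₚ.tabulate-cong same ⟩
  Vec.tabulate (lookup v) ≡⟨ Vecₚ.tabulate∘lookup v ⟩
  v                       ∎
  where open ≡-Reasoning

signed-zero : ∀ e → signed e 0 ≡ 0ℤ
signed-zero Sign.+ = refl
signed-zero Sign.- = refl

signedSum-zeros : ∀ {n k} (ε : Vec Sign k) → signedSum ε (replicate k (Fin.zero {n})) ≡ 0ℤ
signedSum-zeros []      = refl
signedSum-zeros (e ∷ ε) = cong₂ ℤ._+_ (signed-zero e) (signedSum-zeros ε)

signedSum-basis : ∀ {n k} (ε : Vec Sign k) (i : Fin k) →
                  signedSum ε (replicate k (Fin.zero {suc n}) [ i ]≔ Fin.suc Fin.zero) ≡ signed (lookup ε i) 1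
signedSum-basis (e ∷ ε) Fin.zero =
  trans (cong (ℤ._+_ (signed e 1)) (signedSum-zeros ε)) (ℤₚ.+-identityʳ _)
signedSum-basis (e ∷ ε) (Fin.suc i) =
  trans (cong₂ ℤ._+_ (signed-zero e) (signedSum-basis ε i)) (ℤₚ.+-identityˡ _)

Sign-≡ : ∀ {s s′ : Sign} → (s ≡ Sign.+ → s′ ≡ Sign.+) → (s′ ≡ Sign.+ → s ≡ Sign.+) → s ≡ s′
Sign-≡ {Sign.+} {Sign.+} _ _ = refl
Sign-≡ {Sign.-} {Sign.-} _ _ = refl
Sign-≡ {Sign.+} {Sign.-} s⇒s′ _ = sym (s⇒s′ refl)
Sign-≡ {Sign.-} {Sign.+} _ s′⇒s = s′⇒s refl

module Injectivity (m₀ : ℕ) where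

  m : ℕ
  m = suc (suc (suc m₀))

  open ModularArithmetic m
  open Torus m

  zeros : ∀ k → Vec (Fin m) k
  zeros k = replicate k Fin.zero

  linForm-zeros : ∀ {k} (ε : Vec Sign k) x → linForm ε (x ∷ zeros k) ≡ + toℕ x
  linForm-zeros ε x = trans (cong (ℤ._+_ (+ toℕ x)) (signedSum-zeros ε)) (ℤₚ.+-identityʳ _)

  linForm-fromℤ-zeros : ∀ {k} (ε : Vec Sign k) z → linForm ε (fromℤ z ∷ zeros k) ≋ z
  linForm-fromℤ-zeros ε z = ≋-trans (≡⇒≋ (linForm-zeros ε (fromℤ z))) (toℕ-fromℤ z)

  0<h : 0 < h
  0<h = z<s

  origin∈ι : ∀ {k} (q : Fin m) (ε : Vec Sign k) → T (ι m k q ε (q ∷ zeros k))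
  origin∈ι q ε = ι⁺ q ε _ 0<h (≡⇒≋ (trans (linForm-zeros ε q) (cong +_ (sym (+-identityʳ _)))))

  q-injective : ∀ {k} {q q′ : Fin m} {ε ε′ : Vec Sign k} → ι m k q ε ≐ ι m k q′ ε′ → q ≡ q′
  q-injective {k} {q} {q′} {ε} {ε′} same
    with ι⁻ q ε (q′ ∷ zeros k) (subst T (sym (same (q′ ∷ zeros k))) (origin∈ι q′ ε′))
  ... | zero , _ , q′≋q = Finₚ.toℕ-injective (sym (≋⇒≡ (Finₚ.toℕ<n q′) (Finₚ.toℕ<n q)
        (≋-trans (≡⇒≋ (sym (linForm-zeros ε q′))) (≋-trans q′≋q (≡⇒≋ (cong +_ (+-identityʳ _)))))))
  ... | suc s , 1+s<h , q′≋q+2+2s =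
    ⊥-elim (q-2∉ι q′ ε′ below (linForm-fromℤ-zeros ε′ _) (subst T (same below) below∈ι))
    where
    below : Vertex m (suc k)
    below = fromℤ (+ toℕ q′ ℤ.- + 2) ∷ zeros k
    below∈ι : T (ι m k q ε below)
    below∈ι = ι⁺ q ε below (<-trans (n<1+n s) 1+s<h) (begin
      linForm ε below                          ≈⟨ linForm-fromℤ-zeros ε _ ⟩
      + toℕ q′ ℤ.- + 2
        ≈⟨ ≋-+ (≋-trans (≡⇒≋ (sym (linForm-zeros ε q′))) q′≋q+2+2s) (≋-refl {ℤ.- + 2}) ⟩
      + (toℕ q + 2 * suc s) ℤ.- + 2            ≡⟨ cong (λ n → + n ℤ.- + 2) (m+2*[1+n]≡m+2*n+2 (toℕ q) s) ⟩
      (+ (toℕ q + 2 * s) ℤ.+ + 2) ℤ.- + 2      ≡⟨ cancel (+ (toℕ q + 2 * s)) ⟩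
      + (toℕ q + 2 * s)                        ∎)
      where
      open SetoidReasoning ≋-setoid
      cancel : ∀ x → (x ℤ.+ + 2) ℤ.- + 2 ≡ x
      cancel = solve-∀

  probe : ∀ {k} → Fin m → Fin k → Vertex m (suc k)
  probe q i = fromℤ (+ toℕ q ℤ.- 1ℤ) ∷ (zeros _ [ i ]≔ Fin.suc Fin.zero)

  linForm-probe : ∀ {k} (q : Fin m) (ε : Vec Sign k) i {s} → lookup ε i ≡ s →
                  linForm ε (probe q i) ≋ (+ toℕ q ℤ.- 1ℤ) ℤ.+ signed s 1
  linForm-probe q ε i εᵢ≡s =
    ≋-+ (toℕ-fromℤ (+ toℕ q ℤ.- 1ℤ)) (≡⇒≋ (trans (signedSum-basis ε i) (cong (λ s → signed s 1) εᵢ≡s)))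

  probe∈ι⁺ : ∀ {k} (q : Fin m) (ε : Vec Sign k) i → lookup ε i ≡ Sign.+ → T (ι m k q ε (probe q i))
  probe∈ι⁺ q ε i εᵢ≡+ = ι⁺ q ε _ 0<h
    (≋-trans (linForm-probe q ε i εᵢ≡+) (≡⇒≋ (trans (cancel (+ toℕ q)) (cong +_ (sym (+-identityʳ _))))))
    where
    cancel : ∀ x → (x ℤ.- 1ℤ) ℤ.+ 1ℤ ≡ x
    cancel = solve-∀

  probe∈ι⁻ : ∀ {k} (q : Fin m) (ε : Vec Sign k) i → T (ι m k q ε (probe q i)) → lookup ε i ≡ Sign.+
  probe∈ι⁻ q ε i probe∈ι with lookup ε i in εᵢ≡s
  ... | Sign.+ = refl
  ... | Sign.- = ⊥-elim (q-2∉ι q ε _ (≋-trans (linForm-probe q ε i εᵢ≡s) (≡⇒≋ (regroup (+ toℕ q)))) probe∈ι)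
    where
    regroup : ∀ x → (x ℤ.- 1ℤ) ℤ.+ ℤ.- 1ℤ ≡ x ℤ.- + 2
    regroup = solve-∀

  ε-injective : ∀ {k} {q : Fin m} {ε ε′ : Vec Sign k} → ι m k q ε ≐ ι m k q ε′ → ε ≡ ε′
  ε-injective {q = q} {ε} {ε′} same = lookup-extensionality λ i → Sign-≡
    (λ εᵢ≡+ → probe∈ι⁻ q ε′ i (subst T (same (probe q i)) (probe∈ι⁺ q ε i εᵢ≡+)))
    (λ ε′ᵢ≡+ → probe∈ι⁻ q ε i (subst T (sym (same (probe q i))) (probe∈ι⁺ q ε′ i ε′ᵢ≡+)))

  ι-injective : ∀ {k} (q q′ : Fin m) (ε ε′ : Vec Sign k) → ι m k q ε ≐ ι m k q′ ε′ → (q , ε) ≡ (q′ , ε′)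
  ι-injective q q′ ε ε′ same with q-injective {q = q} {q′} {ε} {ε′} same
  ... | refl = cong (q ,_) (ε-injective {q = q} {ε} {ε′} same)

lemma3p2 : (m k : ℕ) → {{_ : NonZero m}} → 3 ≤ m → m % 2 ≡ 1 →
           ((q : Fin m) (ε : Vec Sign k) → IsMaximumIndependent m (suc k) (ι m k q ε))
           × ((q q′ : Fin m) (ε ε′ : Vec Sign k) →
                ι m k q ε ≐ ι m k q′ ε′ → (q , ε) ≡ (q′ , ε′))
lemma3p2 _ k (s≤s (s≤s (s≤s (z≤n {n = m₀})))) odd =
  (λ q ε → ι-independent q ε , ι-maximum q ε odd) , ι-injective
  where
  open Torus (suc (suc (suc m₀)))
  open Injectivity m₀ using (ι-injective)
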